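{- Let $G$ be a finite cubic graph. Then $\mathcal{F}(G,\mathbb{Z}_2\times\mathbb{Z}_2)$ is connected if and only if $\mathcal{K}(G,3)$ is connected.
   Context: Graphs may have multiple edges but no loops. For an abelian group $A$, an $A$-flow in $G$ (with respect to a fixed orientation) is a map $f:E(G)\to A$ such that at every vertex the sum of values on outgoing arcs equals the sum on incoming arcs; it is nowhere-zero if no edge receives $0_A$. (For $A=\mathbb{Z}_2\times\mathbb{Z}_2$ orientations are irrelevant since $a=-a$.) A cycle is a connected 2-regular subgraph. $\mathcal{F}(G,A)$ is the graph whose vertices are the nowhere-zero $A$-flows of $G$, two flows $f,g$ adjacent iff the support $\{e: (f-g)(e)\ne 0\}$ is the edge set of a cycle. The empty graph is considered connected. A proper 3-edge-coloring is considered unlabelled, i.e., as a partition of $E(G)$ into at most 3 classes (color classes), each a matching, colorings differing only by a permutation of colors being identified. Given such a coloring and two of its colors $i,j$, a Kempe chain is a connected component of the subgraph formed by the edges colored $i$ or $j$; a Kempe change exchanges colors $i$ and $j$ on one Kempe chain. $\mathcal{K}(G,3)$ is the graph whose vertices are the unlabelled proper 3-edge-colorings of $G$, two colorings adjacent iff they differ by one Kempe change. -}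

module Defs where

open import Data.Nat using (ℕ; zero; suc; _+_)
open import Data.Bool using (Bool; true; false; _∧_; _∨_; _xor_; if_then_else_)
open import Data.Fin using (Fin; _≟_)
open import Data.List using (List; map; foldr; allFin)
open import Data.Nat.ListAction using (sum)
open import Data.Vec using (Vec; lookup)
open import Data.Product using (Σ; ∃; ∃-syntax; _×_; _,_; proj₁; proj₂)
open import Data.Sum using (_⊎_)
open import Relation.Nullary using (¬_; does)
open import Relation.Binary.PropositionalEquality using (_≡_; _≢_)
open import Relation.Binary.Construct.Closure.ReflexiveTransitive using (Star)
open import Function.Definitions using (Injective)

-- Finite loopless multigraphs: vertices Fin n, edges Fin m,
-- each edge has two (distinct) endpoints; parallel edges allowed.

record Graph : Set where
  field
    n    : ℕ
    m    : ℕ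
    ends : Fin m → Fin n × Fin n
    loopless : ∀ e → proj₁ (ends e) ≢ proj₂ (ends e)

module _ (G : Graph) where
  open Graph G

  inc : Fin m → Fin n → Bool
  inc e v = does (proj₁ (ends e) ≟ v) ∨ does (proj₂ (ends e) ≟ v)

  EdgeSet : Set
  EdgeSet = Fin m → Bool

  deg : EdgeSet → Fin n → ℕ
  deg S v = sum (map (λ e → if S e ∧ inc e v then 1 else 0) (allFin m))

  Cubic : Set
  Cubic = ∀ v → deg (λ _ → true) v ≡ 3

  Touch : Fin m → Fin m → Set
  Touch e e' = ∃[ v ] (inc e v ≡ true × inc e' v ≡ true)

  ConnectedEdges : EdgeSet → Set
  ConnectedEdges S = ∀ e e' → S e ≡ true → S e' ≡ true →
    Star (λ a b → S a ≡ true × S b ≡ true × Touch a b) e e'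

  IsCycle : EdgeSet → Set
  IsCycle S = (∃[ e ] S e ≡ true)
            × (∀ v → deg S v ≡ 0 ⊎ deg S v ≡ 2)
            × ConnectedEdges S

  -- Z2 × Z2 flows (orientation irrelevant since a = -a)

  V4 : Set
  V4 = Bool × Bool

  0V : V4
  0V = false , false

  _⊕_ : V4 → V4 → V4
  (a , b) ⊕ (c , d) = (a xor c) , (b xor d)

  nz : V4 → Bool
  nz (a , b) = a ∨ b

  vsum : Vec V4 m → Fin n → V4
  vsum f v = foldr _⊕_ 0V (map (λ e → if inc e v then lookup f e else 0V) (allFin m))

  IsNZFlow : Vec V4 m → Set
  IsNZFlow f = (∀ v → vsum f v ≡ 0V) × (∀ e → lookup f e ≢ 0V)

  -- f, g adjacent in F(G, Z2×Z2): support of f - g (= f ⊕ g) is a cycle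
  FlowAdj : Vec V4 m → Vec V4 m → Set
  FlowAdj f g = IsNZFlow f × IsNZFlow g × IsCycle (λ e → nz (lookup f e ⊕ lookup g e))

  -- F(G, Z2×Z2) is connected (vacuous if there are no nowhere-zero flows)
  FlowGraphConnected : Set
  FlowGraphConnected = ∀ f g → IsNZFlow f → IsNZFlow g → Star FlowAdj f g

  Colouring : Set
  Colouring = Vec (Fin 3) m

  Proper : Colouring → Set
  Proper c = ∀ e e' → e ≢ e' → Touch e e' → lookup c e ≢ lookup c e'

  Relabel : Colouring → Colouring → Set
  Relabel c d = Σ (Fin 3 → Fin 3) λ π → Injective _≡_ _≡_ π × (∀ e → lookup d e ≡ π (lookup c e))

  Colij : Colouring → Fin 3 → Fin 3 → Fin m → Set
  Colij c i j e = lookup c e ≡ i ⊎ lookup c e ≡ j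

  KempeChain : Colouring → Fin 3 → Fin 3 → EdgeSet → Set
  KempeChain c i j K =
      i ≢ j
    × (∀ e → K e ≡ true → Colij c i j e)
    × (∃[ e ] K e ≡ true)
    × ConnectedEdges K
    × (∀ e e' → K e ≡ true → Colij c i j e' → Touch e e' → K e' ≡ true)

  swapCol : Fin 3 → Fin 3 → Fin 3 → Fin 3
  swapCol i j x = if does (x ≟ i) then j else (if does (x ≟ j) then i else x)

  KempeStep : Colouring → Colouring → Set
  KempeStep c d = ∃[ i ] ∃[ j ] ∃[ K ] (KempeChain c i j K ×
    (∀ e → lookup d e ≡ (if K e then swapCol i j (lookup c e) else lookup c e)))

  -- one step in K(G,3), read on representatives of unlabelled colourings
  KStep : Colouring → Colouring → Set
  KStep c d = Proper c × Proper d × (Relabel c d ⊎ KempeStep c d)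

  -- K(G,3) is connected (vacuous if G has no proper 3-edge-colouring)
  KempeGraphConnected : Set
  KempeGraphConnected = ∀ c d → Proper c → Proper d → Star KStep c d

{-# OPTIONS --safe #-}
module Submission where

-- At a vertex of a cubic graph three non-zero elements of Z₂ × Z₂ sum to zero iff they are pairwise
-- distinct, so the nowhere-zero flows are the labelled proper 3-edge-colourings.  If two of them differ
-- exactly on a cycle, then at each vertex of the cycle the third edge keeps its value, so the other two
-- exchange theirs; walking along the cycle shows that the same two values are exchanged everywhere, i.e.
-- flow adjacency is a Kempe change.  What remains is that flows, unlike colourings, carry labels: a
-- permutation of the labels is a product of transpositions, and the transposition (i j) is the result of
-- changing every (i,j)-chain, one at a time.

open import Defs
open import Algebra.Properties.CommutativeSemigroup using (x∙yz≈y∙xz)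
open import Data.Bool using (Bool; true; false; _∧_; _xor_; if_then_else_)
import Data.Bool.Properties as Bool
open import Data.Empty using (⊥-elim)
open import Data.Fin using (Fin; zero; suc; _≟_)
open import Data.Fin.Properties using (all?; any?)
open import Data.List using (List; []; _∷_; map; foldr; allFin; filter; length)
open import Data.List.Properties using (map-cong)
open import Data.List.Membership.Propositional using (_∈_)
open import Data.List.Membership.Propositional.Properties using (∈-allFin; ∈-filter⁺; ∈-filter⁻; ∈-∃++)
open import Data.List.Relation.Binary.Permutation.Propositional using (_↭_; refl; prep; swap; trans; ↭-sym; ↭-trans; ↭⇒↭ₛ)
open import Data.List.Relation.Binary.Permutation.Propositional.Properties using (∈-resp-↭; ↭-length; shift)
open import Data.List.Relation.Binary.Permutation.Setoid.Properties using (Unique-resp-↭)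
open import Data.List.Relation.Unary.All using ([]; _∷_)
open import Data.List.Relation.Unary.AllPairs using ([]; _∷_)
open import Data.List.Relation.Unary.Any using (here; there)
import Data.List.Relation.Unary.Unique.Propositional.Properties as Unique
open import Data.Nat using (ℕ; zero; suc; _+_)
open import Data.Nat.Properties using (+-commutativeSemigroup)
open import Data.Product using (∃-syntax; _×_; _,_; proj₁; proj₂)
open import Data.Product.Properties using (≡-dec)
open import Data.Sum using (_⊎_; inj₁; inj₂)
open import Data.Vec using (Vec; lookup; tabulate)
import Data.Vec as Vec
import Data.Vec.Properties as Vec
open import Function.Base using (_∘_; id)
open import Function.Bundles using (_⇔_; mk⇔)
open import Function.Definitions using (Injective)
open import Relation.Binary.Construct.Closure.ReflexiveTransitive using (Star; ε; _◅_; _◅◅_; gmap; reverse; return; kleisliStar)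
open import Relation.Binary.Definitions using (Decidable; DecidableEquality)
open import Relation.Binary.PropositionalEquality as ≡ using (_≡_; _≢_; refl; sym; cong; cong₂; subst; subst₂; setoid; module ≡-Reasoning)
open import Relation.Nullary using (¬_; Dec; yes; no; does)
open import Relation.Nullary.Decidable using (from-yes; ¬?; _→-dec_; _×-dec_; _⊎-dec_; dec-true)

-- Paths and decidable reachability on a finite set.

Star-preserves : {A : Set} {R : A → A → Set} (P : A → Set) → (∀ {a b} → P a → R a b → P b) →
  ∀ {a b} → P a → Star R a b → P b
Star-preserves P step pa ε        = pa
Star-preserves P step pa (r ◅ rs) = Star-preserves P step (step pa r) rs

-- Reach l a b: b can be reached from a with all intermediate points in l (Warshall's recursion).
module Reachability {A : Set} (_≟ᴬ_ : DecidableEquality A) {R : A → A → Set} (R? : Decidable R) where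

  Reach : List A → A → A → Set
  Reach []      a b = a ≡ b ⊎ R a b
  Reach (x ∷ l) a b = Reach l a b ⊎ (Reach l a x × Reach l x b)

  reach? : ∀ l → Decidable (Reach l)
  reach? []      a b = (a ≟ᴬ b) ⊎-dec R? a b
  reach? (x ∷ l) a b = reach? l a b ⊎-dec (reach? l a x ×-dec reach? l x b)

  Reach⇒Star : ∀ l {a b} → Reach l a b → Star R a b
  Reach⇒Star []      (inj₁ refl)    = ε
  Reach⇒Star []      (inj₂ r)       = return r
  Reach⇒Star (x ∷ l) (inj₁ p)       = Reach⇒Star l p
  Reach⇒Star (x ∷ l) (inj₂ (p , q)) = Reach⇒Star l p ◅◅ Reach⇒Star l q

  Reach-refl : ∀ l {a} → Reach l a a
  Reach-refl []      = inj₁ refl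
  Reach-refl (x ∷ l) = inj₁ (Reach-refl l)

  R⇒Reach : ∀ l {a b} → R a b → Reach l a b
  R⇒Reach []      r = inj₂ r
  R⇒Reach (x ∷ l) r = inj₁ (R⇒Reach l r)

  -- If the junction `y` is the head `x`, each half is cut at a visit of `x`. If both halves pass
  -- through `x`, the part between the two visits is dropped, so no recursive call is needed there.
  Reach-trans : ∀ l {a y b} → y ∈ l → Reach l a y → Reach l y b → Reach l a b
  Reach-trans (x ∷ l) (here refl) p q = inj₂ (to p , from q)
    where
    to : ∀ {a} → Reach (x ∷ l) a x → Reach l a x
    to (inj₁ p)       = p
    to (inj₂ (p , _)) = p
    from : ∀ {b} → Reach (x ∷ l) x b → Reach l x b
    from (inj₁ q)       = q
    from (inj₂ (_ , q)) = q
  Reach-trans (x ∷ l) (there y∈l) (inj₁ p)        (inj₁ q)        = inj₁ (Reach-trans l y∈l p q)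
  Reach-trans (x ∷ l) (there y∈l) (inj₁ p)        (inj₂ (q , q′)) = inj₂ (Reach-trans l y∈l p q , q′)
  Reach-trans (x ∷ l) (there y∈l) (inj₂ (p , p′)) (inj₁ q)        = inj₂ (p , Reach-trans l y∈l p′ q)
  Reach-trans (x ∷ l) (there y∈l) (inj₂ (p , _))  (inj₂ (_ , q))  = inj₂ (p , q)

  -- Once `l` lists every point, the restriction on intermediate points is void, so `reach?` decides
  -- `Star R`.
  Star⇒Reach : ∀ l → (∀ y → y ∈ l) → ∀ {a b} → Star R a b → Reach l a b
  Star⇒Reach l full ε        = Reach-refl l
  Star⇒Reach l full (r ◅ rs) = Reach-trans l (full _) (R⇒Reach l r) (Star⇒Reach l full rs)

-- Sums over lists, up to reordering and filtering.

extract-∈ : {A : Set} {x : A} {xs : List A} → x ∈ xs → ∃[ ys ] xs ↭ x ∷ ys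
extract-∈ {x = x} x∈xs with ys , zs , refl ← ∈-∃++ x∈xs = _ , shift x ys zs

∈-tail : {A : Set} {x y : A} {xs : List A} → x ≢ y → y ∈ x ∷ xs → y ∈ xs
∈-tail x≢y (here y≡x)   = ⊥-elim (x≢y (sym y≡x))
∈-tail x≢y (there y∈xs) = y∈xs

-- Left-commutativity is exactly what exchanging two neighbours requires. The general form serves
-- both degrees in `ℕ` and vertex sums in Z₂ × Z₂.
foldr-map-↭ : {A B : Set} (_∙_ : B → B → B) (ε₀ : B) → (∀ x y z → x ∙ (y ∙ z) ≡ y ∙ (x ∙ z)) →
  (g : A → B) {xs ys : List A} → xs ↭ ys → foldr _∙_ ε₀ (map g xs) ≡ foldr _∙_ ε₀ (map g ys)
foldr-map-↭ _∙_ ε₀ comm g refl                  = refl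
foldr-map-↭ _∙_ ε₀ comm g (prep x p)            = cong (g x ∙_) (foldr-map-↭ _∙_ ε₀ comm g p)
foldr-map-↭ _∙_ ε₀ comm g (swap x y p) =
  ≡.trans (cong (λ s → g x ∙ (g y ∙ s)) (foldr-map-↭ _∙_ ε₀ comm g p)) (comm (g x) (g y) _)
foldr-map-↭ _∙_ ε₀ comm g (trans p q)           =
  ≡.trans (foldr-map-↭ _∙_ ε₀ comm g p) (foldr-map-↭ _∙_ ε₀ comm g q)

foldr-map-filter : {A B : Set} (_∙_ : B → B → B) (ε₀ : B) → (∀ x → ε₀ ∙ x ≡ x) →
  (p : A → Bool) (g : A → B) (xs : List A) →
  foldr _∙_ ε₀ (map (λ e → if p e then g e else ε₀) xs) ≡
  foldr _∙_ ε₀ (map g (filter (λ e → p e Bool.≟ true) xs))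
foldr-map-filter _∙_ ε₀ idˡ p g []       = refl
foldr-map-filter _∙_ ε₀ idˡ p g (x ∷ xs) with p x
... | true  = cong (g x ∙_) (foldr-map-filter _∙_ ε₀ idˡ p g xs)
... | false = ≡.trans (idˡ _) (foldr-map-filter _∙_ ε₀ idˡ p g xs)

-- Triples of distinct colours and the coding of colours by non-zero elements.

Rainbow : Fin 3 → Fin 3 → Fin 3 → Set
Rainbow x y z = x ≢ y × x ≢ z × y ≢ z

rainbow? : ∀ x y z → Dec (Rainbow x y z)
rainbow? x y z = ¬? (x ≟ y) ×-dec ¬? (x ≟ z) ×-dec ¬? (y ≟ z)

abstract
  rainbow-covers : ∀ x y z i → Rainbow x y z → i ≡ x ⊎ i ≡ y ⊎ i ≡ z
  rainbow-covers = from-yes (all? λ x → all? λ y → all? λ z → all? λ i →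
    rainbow? x y z →-dec ((i ≟ x) ⊎-dec (i ≟ y) ⊎-dec (i ≟ z)))

  -- The common third colour `z` leaves the same two colours for both pairs; if the first entry
  -- changes, the two must have traded places.
  rainbow-exchange : ∀ x y z x′ y′ → Rainbow x y z → Rainbow x′ y′ z → x ≢ x′ → x′ ≡ y × y′ ≡ x
  rainbow-exchange = from-yes (all? λ x → all? λ y → all? λ z → all? λ x′ → all? λ y′ →
    rainbow? x y z →-dec rainbow? x′ y′ z →-dec ¬? (x ≟ x′) →-dec ((x′ ≟ y) ×-dec (y′ ≟ x)))

enc : Fin 3 → Bool × Bool
enc zero             = true , false
enc (suc zero)       = false , true
enc (suc (suc zero)) = true , true

-- The value at the zero element is junk.
dec : Bool × Bool → Fin 3
dec (true  , false) = zero
dec (false , true)  = suc zero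
dec (true  , true)  = suc (suc zero)
dec (false , false) = zero

abstract
  dec-enc : ∀ x → dec (enc x) ≡ x
  dec-enc = from-yes (all? λ x → dec (enc x) ≟ x)

enc-dec : ∀ a → a ≢ (false , false) → enc (dec a) ≡ a
enc-dec (true  , false) _  = refl
enc-dec (false , true)  _  = refl
enc-dec (true  , true)  _  = refl
enc-dec (false , false) nz = ⊥-elim (nz refl)

abstract
  enc≢0 : ∀ x → enc x ≢ (false , false)
  enc≢0 = from-yes (all? λ x → ¬? (≡-dec Bool._≟_ Bool._≟_ (enc x) (false , false)))

-- Distinct `x` and `y` in {i, j} use up both colours, so none is left for `z`.
rainbow-outside : ∀ i j x y z → x ≡ i ⊎ x ≡ j → y ≡ i ⊎ y ≡ j → Rainbow x y z → ¬ (z ≡ i ⊎ z ≡ j)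
rainbow-outside i j x y z (inj₁ refl) (inj₁ refl) (x≢y , _) _ = x≢y refl
rainbow-outside i j x y z (inj₂ refl) (inj₂ refl) (x≢y , _) _ = x≢y refl
rainbow-outside i j x y z (inj₁ refl) (inj₂ refl) (_ , x≢z , y≢z) (inj₁ refl) = x≢z refl
rainbow-outside i j x y z (inj₁ refl) (inj₂ refl) (_ , x≢z , y≢z) (inj₂ refl) = y≢z refl
rainbow-outside i j x y z (inj₂ refl) (inj₁ refl) (_ , x≢z , y≢z) (inj₁ refl) = y≢z refl
rainbow-outside i j x y z (inj₂ refl) (inj₁ refl) (_ , x≢z , y≢z) (inj₂ refl) = x≢z refl

xor-left-comm : ∀ a b c → a xor (b xor c) ≡ b xor (a xor c)
xor-left-comm a b c = ≡.trans (sym (Bool.xor-assoc a b c))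
  (≡.trans (cong (_xor c) (Bool.xor-comm a b)) (Bool.xor-assoc b a c))

-- Degree counts at a vertex with three edges.

indicator : Bool → ℕ
indicator b = if b then 1 else 0

-- The Booleans say which of the three edges at a vertex belong to an edge set: two of them occur
-- only together, the third never.
paired-count : ∀ s t u → (s ≡ true → t ≡ true) → (t ≡ true → s ≡ true) → u ≢ true →
  let k = indicator s + (indicator t + (indicator u + 0)) in k ≡ 0 ⊎ k ≡ 2
paired-count s     t     true  s⇒t t⇒s u≢ = ⊥-elim (u≢ refl)
paired-count true  true  false s⇒t t⇒s u≢ = inj₂ refl
paired-count false false false s⇒t t⇒s u≢ = inj₁ refl
paired-count true  false false s⇒t t⇒s u≢ with () ← s⇒t refl
paired-count false true  false s⇒t t⇒s u≢ with () ← t⇒s refl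

count-third : ∀ {k s t} u → k ≡ indicator s + (indicator t + (indicator u + 0)) → k ≡ 0 ⊎ k ≡ 2 →
  s ≡ true → t ≡ true → u ≡ false
count-third false _    _         _    _    = refl
count-third true  refl (inj₁ ()) refl refl
count-third true  refl (inj₂ ()) refl refl

-- A cycle that uses `s` at a vertex must leave by another edge; when that is not `t`, only `u`
-- remains.
count-mate : ∀ {k s t} u → k ≡ indicator s + (indicator t + (indicator u + 0)) → k ≡ 0 ⊎ k ≡ 2 →
  s ≡ true → t ≡ false → u ≡ true
count-mate true  _    _         _    _    = refl
count-mate false refl (inj₁ ()) refl refl
count-mate false refl (inj₂ ()) refl refl

-- Pointwise equality of vectors and Boolean case distinction.

lookup-ext : {A : Set} {k : ℕ} {u w : Vec A k} → (∀ e → lookup u e ≡ lookup w e) → u ≡ w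
lookup-ext {u = u} {w} eq =
  ≡.trans (sym (Vec.tabulate∘lookup u)) (≡.trans (Vec.tabulate-cong eq) (Vec.tabulate∘lookup w))

if-true : {A : Set} {b : Bool} {x y z : A} → z ≡ (if b then x else y) → b ≡ true → z ≡ x
if-true eq refl = eq

if-false : {A : Set} {b : Bool} {x y z : A} → z ≡ (if b then x else y) → b ≡ false → z ≡ y
if-false eq refl = eq

if-intro : {A : Set} (b : Bool) {x y z : A} → (b ≡ true → z ≡ x) → (b ≡ false → z ≡ y) → z ≡ (if b then x else y)
if-intro true  p q = p refl
if-intro false p q = q refl

module _ (G : Graph) where
  open Graph G

  -- Transpositions of colours and sums of codes, verified over all cases.

  abstract
    swapCol-self : ∀ i x → swapCol G i i x ≡ x
    swapCol-self = from-yes (all? λ i → all? λ x → swapCol G i i x ≟ x)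

    swapCol-injective : ∀ i j x y → swapCol G i j x ≡ swapCol G i j y → x ≡ y
    swapCol-injective = from-yes (all? λ i → all? λ j → all? λ x → all? λ y →
      (swapCol G i j x ≟ swapCol G i j y) →-dec (x ≟ y))

    swapCol-∈ : ∀ i j x → x ≡ i ⊎ x ≡ j → swapCol G i j x ≡ i ⊎ swapCol G i j x ≡ j
    swapCol-∈ = from-yes (all? λ i → all? λ j → all? λ x →
      ((x ≟ i) ⊎-dec (x ≟ j)) →-dec ((swapCol G i j x ≟ i) ⊎-dec (swapCol G i j x ≟ j)))

    swapCol-moves : ∀ i j x → i ≢ j → x ≡ i ⊎ x ≡ j → swapCol G i j x ≢ x
    swapCol-moves = from-yes (all? λ i → all? λ j → all? λ x →
      ¬? (i ≟ j) →-dec ((x ≟ i) ⊎-dec (x ≟ j)) →-dec ¬? (swapCol G i j x ≟ x))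

    swapCol-fixes : ∀ i j x → ¬ (x ≡ i ⊎ x ≡ j) → swapCol G i j x ≡ x
    swapCol-fixes = from-yes (all? λ i → all? λ j → all? λ x →
      ¬? ((x ≟ i) ⊎-dec (x ≟ j)) →-dec (swapCol G i j x ≟ x))

    swapCol-other : ∀ i j x y → x ≡ i ⊎ x ≡ j → y ≡ i ⊎ y ≡ j → x ≢ y → swapCol G i j x ≡ y
    swapCol-other = from-yes (all? λ i → all? λ j → all? λ x → all? λ y →
      ((x ≟ i) ⊎-dec (x ≟ j)) →-dec ((y ≟ i) ⊎-dec (y ≟ j)) →-dec ¬? (x ≟ y) →-dec (swapCol G i j x ≟ y))

    -- Here `t` sends 0 to `p`. As `t` is an involution, `s` has to send 1 to `t q`; it fixes 0
    -- because `t q` is not 0. The value at 2 is then forced.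
    transposition-split : ∀ p q r → Rainbow p q r →
      let t = swapCol G zero p; s = swapCol G (suc zero) (t q) in
      t (s zero) ≡ p × t (s (suc zero)) ≡ q × t (s (suc (suc zero))) ≡ r
    transposition-split = from-yes (all? λ p → all? λ q → all? λ r →
      let t = swapCol G zero p; s = swapCol G (suc zero) (t q) in
      rainbow? p q r →-dec ((t (s zero) ≟ p) ×-dec (t (s (suc zero)) ≟ q) ×-dec (t (s (suc (suc zero))) ≟ r)))

    enc-rainbow : ∀ x y z → Rainbow x y z → _⊕_ G (enc x) (_⊕_ G (enc y) (_⊕_ G (enc z) (0V G))) ≡ 0V G
    enc-rainbow = from-yes (all? λ x → all? λ y → all? λ z → rainbow? x y z →-dec
      ≡-dec Bool._≟_ Bool._≟_ (_⊕_ G (enc x) (_⊕_ G (enc y) (_⊕_ G (enc z) (0V G)))) (0V G))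

    -- Equal `x` and `y` would cancel and leave `enc z`, which is not zero.
    enc-sum-distinct : ∀ x y z → _⊕_ G (enc x) (_⊕_ G (enc y) (_⊕_ G (enc z) (0V G))) ≡ 0V G → x ≢ y
    enc-sum-distinct = from-yes (all? λ x → all? λ y → all? λ z →
      ≡-dec Bool._≟_ Bool._≟_ (_⊕_ G (enc x) (_⊕_ G (enc y) (_⊕_ G (enc z) (0V G)))) (0V G) →-dec ¬? (x ≟ y))

    nz⇒≢ : ∀ x y → nz G (_⊕_ G (enc x) (enc y)) ≡ true → x ≢ y
    nz⇒≢ = from-yes (all? λ x → all? λ y → (nz G (_⊕_ G (enc x) (enc y)) Bool.≟ true) →-dec ¬? (x ≟ y))

    ≢⇒nz : ∀ x y → x ≢ y → nz G (_⊕_ G (enc x) (enc y)) ≡ true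
    ≢⇒nz = from-yes (all? λ x → all? λ y → ¬? (x ≟ y) →-dec (nz G (_⊕_ G (enc x) (enc y)) Bool.≟ true))

  ⊕-left-comm : ∀ x y z → _⊕_ G x (_⊕_ G y z) ≡ _⊕_ G y (_⊕_ G x z)
  ⊕-left-comm (a , a′) (b , b′) (c , c′) = cong₂ _,_ (xor-left-comm a b c) (xor-left-comm a′ b′ c′)

  -- Edges at a vertex; degrees and flow sums computed from them.

  incident : Fin n → List (Fin m)
  incident v = filter (λ e → inc G e v Bool.≟ true) (allFin m)

  ∈-incident : ∀ {e v} → inc G e v ≡ true → e ∈ incident v
  ∈-incident {e} {v} p = ∈-filter⁺ (λ e → inc G e v Bool.≟ true) (∈-allFin e) p

  incident-inc : ∀ {e v} → e ∈ incident v → inc G e v ≡ true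
  incident-inc {v = v} p = proj₂ (∈-filter⁻ (λ e → inc G e v Bool.≟ true) {xs = allFin m} p)

  -- A permutation instead of an equality, so that any two edges at `v` may be named first.
  Claw : Fin n → Fin m → Fin m → Fin m → Set
  Claw v a b c = incident v ↭ a ∷ b ∷ c ∷ []

  claw-swap : ∀ {v a b z} → Claw v a b z → Claw v a z b
  claw-swap p = ↭-trans p (prep _ (swap _ _ refl))

  claw-inc : ∀ {v a b z} → Claw v a b z → inc G a v ≡ true × inc G b v ≡ true × inc G z v ≡ true
  claw-inc p = at (here refl) , at (there (here refl)) , at (there (there (here refl)))
    where
    at : ∀ {e} → e ∈ _ → inc G e _ ≡ true
    at e∈ = incident-inc (∈-resp-↭ (↭-sym p) e∈)

  claw-distinct : ∀ {v a b z} → Claw v a b z → a ≢ b × a ≢ z × b ≢ z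
  claw-distinct {v} p with Unique-resp-↭ (setoid (Fin m)) (↭⇒↭ₛ p)
    (Unique.filter⁺ (λ e → inc G e v Bool.≟ true) (Unique.allFin⁺ m))
  ... | (a≢b ∷ a≢z ∷ []) ∷ (b≢z ∷ []) ∷ [] ∷ [] = a≢b , a≢z , b≢z

  deg-list : ∀ S v {l} → incident v ↭ l → deg G S v ≡ foldr _+_ 0 (map (indicator ∘ S) l)
  deg-list S v {l} p = begin
    deg G S v
      ≡⟨ cong (foldr _+_ 0) (map-cong (λ e → if-∧ (S e) (inc G e v)) (allFin m)) ⟩
    foldr _+_ 0 (map (λ e → if inc G e v then indicator (S e) else 0) (allFin m))
      ≡⟨ foldr-map-filter _+_ 0 (λ _ → refl) (λ e → inc G e v) (indicator ∘ S) (allFin m) ⟩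
    foldr _+_ 0 (map (indicator ∘ S) (incident v))
      ≡⟨ foldr-map-↭ _+_ 0 (x∙yz≈y∙xz +-commutativeSemigroup) (indicator ∘ S) p ⟩
    foldr _+_ 0 (map (indicator ∘ S) l) ∎
    where
    open ≡-Reasoning
    if-∧ : ∀ s t → (if s ∧ t then 1 else 0) ≡ (if t then indicator s else 0)
    if-∧ true  true  = refl
    if-∧ true  false = refl
    if-∧ false true  = refl
    if-∧ false false = refl

  deg-claw : ∀ {v a b z} S → Claw v a b z →
    deg G S v ≡ indicator (S a) + (indicator (S b) + (indicator (S z) + 0))
  deg-claw S p = deg-list S _ p

  vsum-claw : ∀ {v a b z} f → Claw v a b z →
    vsum G f v ≡ _⊕_ G (lookup f a) (_⊕_ G (lookup f b) (_⊕_ G (lookup f z) (0V G)))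
  vsum-claw {v} f p = ≡.trans
    (foldr-map-filter (_⊕_ G) (0V G) (λ _ → refl) (λ e → inc G e v) (lookup f) (allFin m))
    (foldr-map-↭ (_⊕_ G) (0V G) ⊕-left-comm (lookup f) p)

  proper-rainbow : ∀ c → Proper G c → ∀ {v a b z} → Claw v a b z →
    Rainbow (lookup c a) (lookup c b) (lookup c z)
  proper-rainbow c proper {v} p with claw-distinct p | claw-inc p
  ... | a≢b , a≢z , b≢z | ia , ib , iz =
    proper _ _ a≢b (v , ia , ib) , proper _ _ a≢z (v , ia , iz) , proper _ _ b≢z (v , ib , iz)

  touch-sym : ∀ {a b} → Touch G a b → Touch G b a
  touch-sym (v , p , q) = v , q , p

  -- Passing between colourings and flows.

  toFlow : Colouring G → Vec (V4 G) m
  toFlow = Vec.map enc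

  toColouring : Vec (V4 G) m → Colouring G
  toColouring = Vec.map dec

  toColouring-toFlow : ∀ c → toColouring (toFlow c) ≡ c
  toColouring-toFlow c = ≡.trans (sym (Vec.map-∘ dec enc c)) (≡.trans (Vec.map-cong dec-enc c) (Vec.map-id c))

  toFlow-toColouring : ∀ f → IsNZFlow G f → toFlow (toColouring f) ≡ f
  toFlow-toColouring f (_ , f≢0) = lookup-ext λ e → begin
    lookup (toFlow (toColouring f)) e ≡⟨ Vec.lookup-map e enc (toColouring f) ⟩
    enc (lookup (toColouring f) e)    ≡⟨ cong enc (Vec.lookup-map e dec f) ⟩
    enc (dec (lookup f e))            ≡⟨ enc-dec _ (f≢0 e) ⟩
    lookup f e                        ∎
    where open ≡-Reasoning

  -- Spelled as in `FlowAdj`, so that the cycle condition there is definitionally `IsCycle` of this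
  -- set; it consists of the edges on which `c` and `d` differ.
  support : Colouring G → Colouring G → EdgeSet G
  support c d e = nz G (_⊕_ G (lookup (toFlow c) e) (lookup (toFlow d) e))

  support-enc : ∀ c d e → support c d e ≡ nz G (_⊕_ G (enc (lookup c e)) (enc (lookup d e)))
  support-enc c d e = cong₂ (λ x y → nz G (_⊕_ G x y)) (Vec.lookup-map e enc c) (Vec.lookup-map e enc d)

  support⇒≢ : ∀ c d e → support c d e ≡ true → lookup c e ≢ lookup d e
  support⇒≢ c d e p = nz⇒≢ _ _ (≡.trans (sym (support-enc c d e)) p)

  ≢⇒support : ∀ c d e → lookup c e ≢ lookup d e → support c d e ≡ true
  ≢⇒support c d e p = ≡.trans (support-enc c d e) (≢⇒nz _ _ p)

  ¬support⇒≡ : ∀ c d e → support c d e ≡ false → lookup c e ≡ lookup d e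
  ¬support⇒≡ c d e p with lookup c e ≟ lookup d e
  ... | yes eq = eq
  ... | no  ne with () ← ≡.trans (sym p) (≢⇒support c d e ne)

  -- Kempe changes, and the Kempe chain through a given edge.

  KempeChange : Colouring G → Fin 3 → Fin 3 → EdgeSet G → Colouring G → Set
  KempeChange c i j K d = ∀ e → lookup d e ≡ (if K e then swapCol G i j (lookup c e) else lookup c e)

  -- Only a pair with one edge in `K` is delicate: a clash would give the outer edge colour `i` or
  -- `j`, and closedness of the chain would put it into `K`.
  kempe-proper : ∀ c d {i j K} → Proper G c → KempeChain G c i j K → KempeChange c i j K d → Proper G d
  kempe-proper c d {i} {j} {K} proper (i≢j , ⊆ij , _ , _ , closed) change e e′ e≢e′ t eq =
    go (K e) (K e′) refl refl
    where
    on : ∀ {a} → K a ≡ true → lookup d a ≡ swapCol G i j (lookup c a)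
    on {a} = if-true (change a)
    off : ∀ {a} → K a ≡ false → lookup d a ≡ lookup c a
    off {a} = if-false (change a)
    mixed : ∀ a b → Touch G a b → K a ≡ true → K b ≡ false → lookup d a ≢ lookup d b
    mixed a b t ka kb eq with () ← ≡.trans (sym kb) (closed a b ka
      (subst (λ x → x ≡ i ⊎ x ≡ j) (≡.trans (sym (on ka)) (≡.trans eq (off kb))) (swapCol-∈ i j _ (⊆ij a ka))) t)
    go : ∀ s s′ → K e ≡ s → K e′ ≡ s′ → _
    go true  true  ke ke′ =
      proper e e′ e≢e′ t (swapCol-injective i j _ _ (≡.trans (sym (on ke)) (≡.trans eq (on ke′))))
    go false false ke ke′ = proper e e′ e≢e′ t (≡.trans (sym (off ke)) (≡.trans eq (off ke′)))
    go true  false ke ke′ = mixed e e′ t ke ke′ eq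
    go false true  ke ke′ = mixed e′ e (touch-sym t) ke′ ke (sym eq)

  module _ (c : Colouring G) (i j : Fin 3) (i≢j : i ≢ j) (x : Fin m) (x∈ij : Colij G c i j x) where

    Link : Fin m → Fin m → Set
    Link a b = Colij G c i j a × Colij G c i j b × Touch G a b

    colij? : ∀ e → Dec (Colij G c i j e)
    colij? e = (lookup c e ≟ i) ⊎-dec (lookup c e ≟ j)

    link? : Decidable Link
    link? a b = colij? a ×-dec colij? b ×-dec any? λ v → (inc G a v Bool.≟ true) ×-dec (inc G b v Bool.≟ true)

    open Reachability _≟_ link?

    -- An `EdgeSet` is Boolean-valued, so the component has to be cut out by the decision procedure
    -- for reachability from `x`.
    component : EdgeSet G
    component e = does (reach? (allFin m) x e)

    component⇒Star : ∀ {e} → component e ≡ true → Star Link x e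
    component⇒Star {e} p with reach? (allFin m) x e
    ... | yes r = Reach⇒Star (allFin m) r
    ... | no  _ with () ← p

    Star⇒component : ∀ {e} → Star Link x e → component e ≡ true
    Star⇒component {e} s = dec-true (reach? (allFin m) x e) (Star⇒Reach (allFin m) ∈-allFin s)

    component-kempe : KempeChain G c i j component
    component-kempe = i≢j , ⊆ij , (x , Star⇒component ε) , connected , closed
      where
      ⊆ij : ∀ e → component e ≡ true → Colij G c i j e
      ⊆ij e p = Star-preserves (Colij G c i j) (λ _ (_ , q , _) → q) x∈ij (component⇒Star p)
      closed : ∀ e e′ → component e ≡ true → Colij G c i j e′ → Touch G e e′ → component e′ ≡ true
      closed e e′ p q t = Star⇒component (component⇒Star p ◅◅ return (⊆ij e p , q , t))
      Inside : Fin m → Fin m → Set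
      Inside a b = component a ≡ true × component b ≡ true × Touch G a b
      inside : ∀ {a b} → component a ≡ true → Star Link a b → Star Inside a b
      inside p ε                  = ε
      inside p ((_ , q , t) ◅ rs) = (p , closed _ _ p q t , t) ◅ inside (closed _ _ p q t) rs
      connected : ConnectedEdges G component
      connected e e′ p p′ =
        -- Any two edges of the component are joined through `x`: back along the path to `e`, then
        -- out to `e′`.
        reverse (λ (a , b , t) → b , a , touch-sym t) (inside (Star⇒component ε) (component⇒Star p))
        ◅◅ inside (Star⇒component ε) (component⇒Star p′)

  -- Cubic graphs: nowhere-zero flows are proper colourings.

  module _ (cubic : Cubic G) where

    abstract
      three : ∀ v → length (incident v) ≡ 3
      three v = ≡.trans (sym (sum-ones (incident v)))
        (≡.trans (sym (deg-list (λ _ → true) v refl)) (cubic v))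
        where
        sum-ones : {A : Set} (l : List A) → foldr _+_ 0 (map (λ _ → 1) l) ≡ length l
        sum-ones []      = refl
        sum-ones (_ ∷ l) = cong suc (sum-ones l)

      claw : ∀ v → ∃[ a ] ∃[ b ] ∃[ z ] Claw v a b z
      claw v = go (incident v) (three v)
        where
        go : ∀ (l : List (Fin m)) → length l ≡ 3 → ∃[ a ] ∃[ b ] ∃[ z ] l ↭ a ∷ b ∷ z ∷ []
        go (a ∷ b ∷ z ∷ []) refl = a , b , z , refl

      -- Moving `a` and `b` to the front of a list of length three leaves exactly one further edge.
      claw-extend : ∀ {v a b} → inc G a v ≡ true → inc G b v ≡ true → a ≢ b → ∃[ z ] Claw v a b z
      claw-extend {v} {a} {b} ia ib a≢b
        with l , p ← extract-∈ (∈-incident ia)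
        with l′ , q ← extract-∈ (∈-tail a≢b (∈-resp-↭ p (∈-incident ib)))
        = go l′ r (≡.trans (sym (↭-length r)) (three v))
        where
        r : incident v ↭ a ∷ b ∷ l′
        r = ↭-trans p (prep a q)
        go : ∀ l → incident v ↭ a ∷ b ∷ l → suc (suc (length l)) ≡ 3 → ∃[ z ] Claw v a b z
        go (z ∷ []) r refl = z , r

    coloured-edge : ∀ c → Proper G c → ∀ v i → ∃[ e ] (inc G e v ≡ true × lookup c e ≡ i)
    coloured-edge c proper v i with a , b , z , p ← claw v
      with ia , ib , iz ← claw-inc p
      with rainbow-covers _ _ _ i (proper-rainbow c proper p)
    ... | inj₁ eq        = a , ia , sym eq
    ... | inj₂ (inj₁ eq) = b , ib , sym eq
    ... | inj₂ (inj₂ eq) = z , iz , sym eq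

    proper⇒flow : ∀ c → Proper G c → IsNZFlow G (toFlow c)
    proper⇒flow c proper = conserved , λ e → subst (_≢ 0V G) (sym (Vec.lookup-map e enc c)) (enc≢0 (lookup c e))
      where
      conserved : ∀ v → vsum G (toFlow c) v ≡ 0V G
      conserved v with a , b , z , p ← claw v = begin
        vsum G (toFlow c) v ≡⟨ vsum-claw (toFlow c) p ⟩
        _ ≡⟨ cong₂ (_⊕_ G) (at a) (cong₂ (_⊕_ G) (at b) (cong₂ (_⊕_ G) (at z) refl)) ⟩
        _ ≡⟨ enc-rainbow _ _ _ (proper-rainbow c proper p) ⟩
        0V G ∎
        where
        open ≡-Reasoning
        at : ∀ e → lookup (toFlow c) e ≡ enc (lookup c e)
        at e = Vec.lookup-map e enc c

    -- Two touching edges are completed to the claw at a common vertex, where conservation is a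
    -- vanishing sum of three codes.
    flow⇒proper : ∀ c → IsNZFlow G (toFlow c) → Proper G c
    flow⇒proper c (conserved , _) e e′ e≢e′ (v , ie , ie′)
      with z , p ← claw-extend ie ie′ e≢e′ = enc-sum-distinct _ _ (lookup c z) (begin
        _ ≡⟨ cong₂ (_⊕_ G) (at e) (cong₂ (_⊕_ G) (at e′) (cong₂ (_⊕_ G) (at z) refl)) ⟩
        _ ≡⟨ vsum-claw (toFlow c) p ⟨
        vsum G (toFlow c) v ≡⟨ conserved v ⟩
        0V G ∎)
        where
        open ≡-Reasoning
        at : ∀ e → enc (lookup c e) ≡ lookup (toFlow c) e
        at e = sym (Vec.lookup-map e enc c)

    -- Flow adjacency is a Kempe change.

    kempe⇒flowAdj : ∀ c d {i j K} → Proper G c → KempeChain G c i j K → KempeChange c i j K d →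
      FlowAdj G (toFlow c) (toFlow d)
    kempe⇒flowAdj c d {i} {j} {K} proper chain@(i≢j , ⊆ij , (e₀ , ke₀) , connected , closed) change =
      proper⇒flow c proper , proper⇒flow d (kempe-proper c d proper chain change) ,
      (e₀ , K⇒S ke₀) , degrees , λ e e′ p q →
        gmap id (λ (a , b , t) → K⇒S a , K⇒S b , t) (connected e e′ (S⇒K p) (S⇒K q))
      where
      S : EdgeSet G
      S = support c d
      -- The support is exactly `K`, since the exchange moves both `i` and `j`; connectedness is
      -- therefore inherited from the chain.
      K⇒S : ∀ {e} → K e ≡ true → S e ≡ true
      K⇒S {e} ke = ≢⇒support c d e λ eq →
        swapCol-moves i j _ i≢j (⊆ij e ke) (sym (≡.trans eq (if-true (change e) ke)))
      S⇒K : ∀ {e} → S e ≡ true → K e ≡ true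
      S⇒K {e} se = Bool.¬-not λ ke → support⇒≢ c d e se (sym (if-false (change e) ke))
      degrees : ∀ v → deg G S v ≡ 0 ⊎ deg G S v ≡ 2
      -- The edges of colours `i` and `j` at `v` touch, so the chain contains both or neither; the
      -- third edge has the third colour and is never in it.
      degrees v with a , ia , ca ← coloured-edge c proper v i | b , ib , cb ← coloured-edge c proper v j
        with z , p ← claw-extend ia ib (λ { refl → i≢j (≡.trans (sym ca) cb) })
        = subst (λ k → k ≡ 0 ⊎ k ≡ 2) (sym (deg-claw S p)) (paired-count (S a) (S b) (S z)
          (λ sa → K⇒S (closed a b (S⇒K sa) (inj₂ cb) (v , ia , ib)))
          (λ sb → K⇒S (closed b a (S⇒K sb) (inj₁ ca) (v , ib , ia)))
          (λ sz → rainbow-outside i j _ _ _ (inj₁ ca) (inj₂ cb) (proper-rainbow c proper p) (⊆ij z (S⇒K sz))))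

    -- The cycle itself is the chain, and its two colours are read off from the single edge `e₀`.
    flowAdj⇒kempe : ∀ c d → FlowAdj G (toFlow c) (toFlow d) → KempeStep G c d
    flowAdj⇒kempe c d (flow-c , flow-d , (e₀ , se₀) , degrees , connected) =
      i , j , S , (support⇒≢ c d e₀ se₀ , (λ e se → proj₁ (exchanged e se)) , (e₀ , se₀) , connected , closed) ,
      λ e → if-intro (S e) (λ se → proj₂ (exchanged e se)) (λ se → sym (¬support⇒≡ c d e se))
      where
      S : EdgeSet G
      S = support c d
      i j : Fin 3
      i = lookup c e₀
      j = lookup d e₀
      proper-c : Proper G c
      proper-c = flow⇒proper c flow-c
      proper-d : Proper G d
      proper-d = flow⇒proper d flow-d

      -- Off the cycle `z` keeps its colour, so `a` and `b` share the same two colours before and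
      -- after.
      crossing : ∀ {v a b z} → Claw v a b z → S a ≡ true → S z ≡ false →
        lookup d a ≡ lookup c b × lookup d b ≡ lookup c a
      crossing {a = a} {b} {z} p sa sz = rainbow-exchange _ _ _ _ _ (proper-rainbow c proper-c p)
        (subst (Rainbow _ _) (sym (¬support⇒≡ c d z sz)) (proper-rainbow d proper-d p)) (support⇒≢ c d a sa)

      third : ∀ {v a b z} → Claw v a b z → S a ≡ true → S b ≡ true → S z ≡ false
      third {v} {z = z} p sa sb = count-third (S z) (deg-claw S p) (degrees v) sa sb

      mate : ∀ {v a b z} → Claw v a b z → S a ≡ true → S b ≡ false → S z ≡ true
      mate {v} {z = z} p sa sb = count-mate (S z) (deg-claw S p) (degrees v) sa sb

      -- Both directions of the exchange are needed, since consecutive edges of the cycle alternate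
      -- between them.
      P : Fin m → Set
      P e = (lookup c e ≡ i × lookup d e ≡ j) ⊎ (lookup c e ≡ j × lookup d e ≡ i)

      P-step : ∀ {a b} → P a → S a ≡ true × S b ≡ true × Touch G a b → P b
      P-step {a} {b} pa (sa , sb , v , ia , ib) with a ≟ b
      ... | yes refl = pa
      ... | no a≢b with z , p ← claw-extend ia ib a≢b
        with crossing p sa (third p sa sb) | pa
      ...   | da , db | inj₁ (ca≡i , da≡j) = inj₂ (≡.trans (sym da) da≡j , ≡.trans db ca≡i)
      ...   | da , db | inj₂ (ca≡j , da≡i) = inj₁ (≡.trans (sym da) da≡i , ≡.trans db ca≡j)

      P-all : ∀ e → S e ≡ true → P e
      P-all e se = Star-preserves P P-step (inj₁ (refl , refl)) (connected e₀ e se₀ se)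

      P⇒c∈ : ∀ {e} → P e → Colij G c i j e
      P⇒c∈ (inj₁ (eq , _)) = inj₁ eq
      P⇒c∈ (inj₂ (eq , _)) = inj₂ eq

      P⇒d∈ : ∀ {e} → P e → Colij G d i j e
      P⇒d∈ (inj₁ (_ , eq)) = inj₂ eq
      P⇒d∈ (inj₂ (_ , eq)) = inj₁ eq

      exchanged : ∀ e → S e ≡ true → Colij G c i j e × lookup d e ≡ swapCol G i j (lookup c e)
      exchanged e se with pe ← P-all e se = P⇒c∈ pe ,
        sym (swapCol-other i j _ _ (P⇒c∈ pe) (P⇒d∈ pe) (support⇒≢ c d e se))

      -- If `e′` were off the cycle, the cycle would leave `v` by the third edge `z`; then `e` and
      -- `z` would take both `i` and `j`, leaving neither for `e′`.
      closed : ∀ e e′ → S e ≡ true → Colij G c i j e′ → Touch G e e′ → S e′ ≡ true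
      closed e e′ se ce′ (v , ie , ie′) with e ≟ e′
      ... | yes refl = se
      ... | no e≢e′ with z , p ← claw-extend ie ie′ e≢e′ = Bool.¬-not λ se′ →
        rainbow-outside i j _ _ _ (P⇒c∈ (P-all e se)) (P⇒c∈ (P-all z (mate p se se′)))
          (proper-rainbow c proper-c (claw-swap p)) ce′

    -- Relabellings realised by paths of flows.

    FlowPath : Colouring G → Colouring G → Set
    FlowPath c d = Star (FlowAdj G) (toFlow c) (toFlow d)

    -- The chains meeting l are exchanged one after the other; each exchange fixes at least the head of l.
    swap-on : ∀ {i j} → i ≢ j → ∀ d → Proper G d → (l : List (Fin m)) → ∀ c → Proper G c →
      (∀ e → lookup c e ≡ lookup d e ⊎ (Colij G c i j e × lookup d e ≡ swapCol G i j (lookup c e))) →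
      (∀ e → lookup c e ≢ lookup d e → e ∈ l) → FlowPath c d
    swap-on i≢j d proper-d [] c proper-c status todo = subst (FlowPath c) (lookup-ext same) ε
      where
      same : ∀ e → lookup c e ≡ lookup d e
      same e with lookup c e ≟ lookup d e
      ... | yes eq = eq
      ... | no ne with () ← todo e ne
    swap-on {i} {j} i≢j d proper-d (x ∷ l) c proper-c status todo with lookup c x ≟ lookup d x | status x
    ... | yes eq | _ = swap-on i≢j d proper-d l c proper-c status
      λ e ne → ∈-tail (λ { refl → ne eq }) (todo e ne)
    ... | no ne | inj₁ eq = ⊥-elim (ne eq)
    ... | no ne | inj₂ (x∈ij , _) =
      kempe⇒flowAdj c c′ proper-c chain change ◅ swap-on i≢j d proper-d l c′ (kempe-proper c c′ proper-c chain change) status′ todo′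
      where
      K : EdgeSet G
      K = component c i j i≢j x x∈ij
      chain : KempeChain G c i j K
      chain = component-kempe c i j i≢j x x∈ij
      c′ : Colouring G
      c′ = tabulate λ e → if K e then swapCol G i j (lookup c e) else lookup c e
      change : KempeChange c i j K c′
      change = Vec.lookup∘tabulate _

      -- Unfinished edges form whole chains: were `b` finished next to an unfinished `a`, then `d`
      -- would give `a` the colour `c` gives `b`, hence the colour `d` gives `b`, and `d` would not
      -- be proper.
      differs-step : ∀ {a b} → lookup c a ≢ lookup d a → Link c i j i≢j x x∈ij a b → lookup c b ≢ lookup d b
      differs-step {a} {b} ne (a∈ , b∈ , t) eq with status a
      ... | inj₁ eq′ = ne eq′
      ... | inj₂ (_ , da) with a ≟ b
      ...   | yes refl = ne eq
      ...   | no a≢b = proper-d a b a≢b t (≡.trans da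
        (≡.trans (swapCol-other i j _ _ a∈ b∈ (proper-c a b a≢b t)) eq))

      done : ∀ e → K e ≡ true → lookup c′ e ≡ lookup d e
      done e ke with status e
      ... | inj₂ (_ , de) = ≡.trans (if-true (change e) ke) (sym de)
      ... | inj₁ eq = ⊥-elim (Star-preserves (λ e → lookup c e ≢ lookup d e) differs-step ne
                        (component⇒Star c i j i≢j x x∈ij ke) eq)

      status′ : ∀ e → lookup c′ e ≡ lookup d e ⊎ (Colij G c′ i j e × lookup d e ≡ swapCol G i j (lookup c′ e))
      status′ e with K e in ke
      ... | true  = inj₁ (done e ke)
      ... | false rewrite if-false (change e) ke = status e

      todo′ : ∀ e → lookup c′ e ≢ lookup d e → e ∈ l
      todo′ e ne′ with K e in ke
      ... | true  = ⊥-elim (ne′ (done e ke))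
      -- The head `x` lies in `K`, so an edge outside `K` that is still unfinished is in the tail.
      ... | false = ∈-tail (λ { refl → x∉K ke }) (todo e (λ eq → ne′ (≡.trans (if-false (change e) ke) eq)))
        where
        x∉K : K x ≢ false
        x∉K kx with () ← ≡.trans (sym kx) (Star⇒component c i j i≢j x x∈ij ε)

    relabel-proper : ∀ c (π : Fin 3 → Fin 3) → Injective _≡_ _≡_ π → Proper G c → Proper G (Vec.map π c)
    relabel-proper c π inj proper e e′ e≢e′ t eq = proper e e′ e≢e′ t (inj (≡.trans (sym (Vec.lookup-map e π c))
      (≡.trans eq (Vec.lookup-map e′ π c))))

    swap-path : ∀ i j c → Proper G c → FlowPath c (Vec.map (swapCol G i j) c)
    swap-path i j c proper with i ≟ j
    -- A `KempeChain` has two different colours; for `i` equal to `j` the transposition is the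
    -- identity and the empty path suffices.
    ... | yes refl = subst (FlowPath c) (sym (≡.trans (Vec.map-cong (swapCol-self i) c) (Vec.map-id c))) ε
    ... | no i≢j = swap-on i≢j (Vec.map (swapCol G i j) c) (relabel-proper c (swapCol G i j) (swapCol-injective i j _ _) proper)
                     (allFin m) c proper status (λ e _ → ∈-allFin e)
      where
      status : ∀ e → lookup c e ≡ lookup (Vec.map (swapCol G i j) c) e ⊎
        (Colij G c i j e × lookup (Vec.map (swapCol G i j) c) e ≡ swapCol G i j (lookup c e))
      status e rewrite Vec.lookup-map e (swapCol G i j) c with (lookup c e ≟ i) ⊎-dec (lookup c e ≟ j)
      ... | yes c∈ = inj₂ (c∈ , refl)
      ... | no  c∉ = inj₁ (sym (swapCol-fixes i j _ c∉))

    relabel-path : ∀ c d → Proper G c → Relabel G c d → FlowPath c d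
    relabel-path c d proper (π , inj , d≡πc) =
      subst (FlowPath c) (lookup-ext agree)
        -- `π` is `t` after `s`, so the path carries out `s` first.
        (swap-path _ _ c proper ◅◅ swap-path _ _ (Vec.map s c) (relabel-proper c s (swapCol-injective _ _ _ _) proper))
      where
      t s : Fin 3 → Fin 3
      t = swapCol G zero (π zero)
      s = swapCol G (suc zero) (t (π (suc zero)))
      ts≡π : ∀ x → t (s x) ≡ π x
      ts≡π x with transposition-split (π zero) (π (suc zero)) (π (suc (suc zero)))
        ((λ eq → case-01 (inj eq)) , (λ eq → case-02 (inj eq)) , (λ eq → case-12 (inj eq)))
        where
        case-01 : _≢_ {A = Fin 3} zero (suc zero)
        case-01 ()
        case-02 : _≢_ {A = Fin 3} zero (suc (suc zero))
        case-02 ()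
        case-12 : _≢_ {A = Fin 3} (suc zero) (suc (suc zero))
        case-12 ()
      ts≡π zero             | p , _ , _ = p
      ts≡π (suc zero)       | _ , q , _ = q
      ts≡π (suc (suc zero)) | _ , _ , r = r
      agree : ∀ e → lookup (Vec.map t (Vec.map s c)) e ≡ lookup d e
      agree e = begin
        lookup (Vec.map t (Vec.map s c)) e ≡⟨ Vec.lookup-map e t (Vec.map s c) ⟩
        t (lookup (Vec.map s c) e)         ≡⟨ cong t (Vec.lookup-map e s c) ⟩
        t (s (lookup c e))                 ≡⟨ ts≡π (lookup c e) ⟩
        π (lookup c e)                     ≡⟨ d≡πc e ⟨
        lookup d e                         ∎
        where open ≡-Reasoning

    -- Transfer of paths between the two graphs.

    KStep⇒FlowPath : ∀ c d → KStep G c d → FlowPath c d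
    KStep⇒FlowPath c d (proper-c , _ , inj₁ relabel)                    = relabel-path c d proper-c relabel
    KStep⇒FlowPath c d (proper-c , _ , inj₂ (_ , _ , _ , chain , change)) = return (kempe⇒flowAdj c d proper-c chain change)

    flow⇒proper-toColouring : ∀ f → IsNZFlow G f → Proper G (toColouring f)
    flow⇒proper-toColouring f flow = flow⇒proper (toColouring f) (subst (IsNZFlow G) (sym (toFlow-toColouring f flow)) flow)

    FlowAdj⇒KStep : ∀ f g → FlowAdj G f g → KStep G (toColouring f) (toColouring g)
    FlowAdj⇒KStep f g adj@(flow-f , flow-g , _) =
      flow⇒proper-toColouring f flow-f , flow⇒proper-toColouring g flow-g ,
      inj₂ (flowAdj⇒kempe (toColouring f) (toColouring g) (subst₂ (FlowAdj G) (sym (toFlow-toColouring f flow-f)) (sym (toFlow-toColouring g flow-g)) adj))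

theorem4p1 : (G : Graph) → Cubic G → FlowGraphConnected G ⇔ KempeGraphConnected G
theorem4p1 G cubic = mk⇔
  (λ connected c d proper-c proper-d →
    subst₂ (Star (KStep G)) (toColouring-toFlow G c) (toColouring-toFlow G d)
      (gmap (toColouring G) (λ {f} {g} → FlowAdj⇒KStep G cubic f g)
        (connected (toFlow G c) (toFlow G d) (proper⇒flow G cubic c proper-c) (proper⇒flow G cubic d proper-d))))
  (λ connected f g flow-f flow-g →
    subst₂ (Star (FlowAdj G)) (toFlow-toColouring G f flow-f) (toFlow-toColouring G g flow-g)
      -- A single step between colourings may be a relabelling, which becomes a whole path of flows;
      -- hence `kleisliStar` here and `gmap` in the other direction.
      (kleisliStar (toFlow G) (λ {c} {d} → KStep⇒FlowPath G cubic c d)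
        (connected (toColouring G f) (toColouring G g)
          (flow⇒proper-toColouring G cubic f flow-f) (flow⇒proper-toColouring G cubic g flow-g))))
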